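{- Let $\mathfrak{a}_{1},\mathfrak{a}_2,\ldots\in GL_l(\mathbb{C})$. For all $m\geq 1$, $$\det \mathfrak{Q}_{m}=\det \mathfrak{p}_{m}(\mathfrak{a}_{1},\ldots,\mathfrak{a}_{m}).$$
   Context: $I$, $O$ are the $l\times l$ identity and zero matrices. The left matrix signed Chebyshev polynomials are defined by $\mathfrak{p}_{ -1}=O$, $\mathfrak{p}_{0}=I$ and $$\mathfrak{p}_{m}(\mathfrak{a}_{1},\ldots,\mathfrak{a}_{m})=\mathfrak{a}_{m}\mathfrak{p}_{m-1}(\mathfrak{a}_{1},\ldots,\mathfrak{a}_{m-1})-\mathfrak{p}_{m-2}(\mathfrak{a}_{1},\ldots,\mathfrak{a}_{m-2}),\quad m\ge 1.$$ $\mathfrak{Q}_1=\mathfrak{a}_1$ and, for $m\ge 2$, $\mathfrak{Q}_m$ is the block tridiagonal $ml\times ml$ matrix with diagonal blocks $\mathfrak{a}_{m},\mathfrak{a}_{m-1},\ldots,\mathfrak{a}_1$ (from top left to bottom right), all blocks immediately above and immediately below the diagonal equal to $I$, and all other blocks equal to $O$: $$\mathfrak{Q}_{m}=\begin{pmatrix} \mathfrak{a}_{m} & I & O & \cdots & O\\ I & \mathfrak{a}_{m-1} & \ddots & \ddots & \vdots\\ O & \ddots & \ddots & \ddots & O\\ \vdots & \ddots & \ddots & \ddots & I\\ O & \cdots & O & I & \mathfrak{a}_{1}\end{pmatrix}.$$ -}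

module Defs where

open import Algebra.Bundles using (CommutativeRing)
open import Algebra.Definitions using (Invertible)
import Algebra.Properties.CommutativeMonoid.Sum as Sum
import Algebra.Properties.Semiring.Exp as Exp
open import Data.Bool.Base using (if_then_else_)
open import Data.Fin.Base using (Fin; zero; suc; toℕ; punchIn; quotient; remainder)
import Data.Fin.Properties as Fin
open import Data.Nat.Base as ℕ using (ℕ; zero; suc)
import Data.Nat.Properties as ℕ
open import Data.Product.Base using (∃; _,_; _×_)
open import Data.Rational.Base as ℚ using (ℚ; 0ℚ; 1ℚ; ∣_∣; Positive; 1/_)
import Data.Rational.Properties as ℚ
open import Level using (0ℓ; _⊔_)
open import Relation.Binary.Definitions using (Reflexive; Symmetric; Transitive)
open import Relation.Binary.PropositionalEquality as ≡ using (_≡_)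
open import Relation.Nullary.Decidable.Core using (⌊_⌋; _⊎-dec_; dec⇒maybe)
open import Tactic.RingSolver using (solve-∀)
open import Tactic.RingSolver.Core.AlmostCommutativeRing
  using (AlmostCommutativeRing; fromCommutativeRing)

private
  ℚ-ring : AlmostCommutativeRing 0ℓ 0ℓ
  ℚ-ring = fromCommutativeRing ℚ.+-*-commutativeRing (λ x → dec⇒maybe (0ℚ ℚ.≟ x))

-- ℝ is the setoid of Cauchy sequences of rationals, modulo null sequences.
module Real where

  IsCauchy : (ℕ → ℚ) → Set
  IsCauchy s = ∀ ε → 0ℚ ℚ.< ε → ∃ λ N → ∀ m n → N ℕ.≤ m → N ℕ.≤ n →
               ∣ s m ℚ.- s n ∣ ℚ.< ε

  record ℝ : Set where
    constructor mkℝ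
    field
      seq    : ℕ → ℚ
      cauchy : IsCauchy seq

  open ℝ public

  infix 4 _≃_

  record _≃_ (x y : ℝ) : Set where
    constructor mk≃
    field
      null : ∀ ε → 0ℚ ℚ.< ε → ∃ λ N → ∀ n → N ℕ.≤ n →
             ∣ seq x n ℚ.- seq y n ∣ ℚ.< ε

  open _≃_ public

  private
    halve : ∀ ε → 0ℚ ℚ.< ε → ∃ λ δ → 0ℚ ℚ.< δ × δ ℚ.+ δ ≡ ε
    halve ε ε>0 = ℚ.½ ℚ.* ε , δ>0 , eq
      where
      δ>0 : 0ℚ ℚ.< ℚ.½ ℚ.* ε
      δ>0 = ≡.subst (ℚ._< ℚ.½ ℚ.* ε) (ℚ.*-zeroʳ ℚ.½) (ℚ.*-monoʳ-<-pos ℚ.½ ε>0)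
      eq : ℚ.½ ℚ.* ε ℚ.+ ℚ.½ ℚ.* ε ≡ ε
      eq = ≡.trans (≡.sym (ℚ.*-distribʳ-+ ε ℚ.½ ℚ.½)) (ℚ.*-identityˡ ε)

    +-close : ∀ p q {δ δ′ ε} → ∣ p ∣ ℚ.< δ → ∣ q ∣ ℚ.< δ′ → δ ℚ.+ δ′ ≡ ε →
              ∣ p ℚ.+ q ∣ ℚ.< ε
    +-close p q p< q< ≡.refl =
      ℚ.≤-<-trans (ℚ.∣p+q∣≤∣p∣+∣q∣ p q) (ℚ.+-mono-< p< q<)

    ∣x-x∣<ε : ∀ x {ε} → 0ℚ ℚ.< ε → ∣ x ℚ.- x ∣ ℚ.< ε
    ∣x-x∣<ε x ε>0 = ≡.subst (λ z → ∣ z ∣ ℚ.< _) (≡.sym (ℚ.+-inverseʳ x)) ε>0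

    neg-sub : ∀ x y → ℚ.- (x ℚ.- y) ≡ ℚ.- x ℚ.- ℚ.- y
    neg-sub = solve-∀ ℚ-ring

    swap-sub : ∀ x y → ℚ.- (x ℚ.- y) ≡ y ℚ.- x
    swap-sub = solve-∀ ℚ-ring

    split-sub : ∀ x y z → (x ℚ.- y) ℚ.+ (y ℚ.- z) ≡ x ℚ.- z
    split-sub = solve-∀ ℚ-ring

    +-sub : ∀ a b c d → (a ℚ.- c) ℚ.+ (b ℚ.- d) ≡ (a ℚ.+ b) ℚ.- (c ℚ.+ d)
    +-sub = solve-∀ ℚ-ring

    *-sub : ∀ a b c d → a ℚ.* (b ℚ.- d) ℚ.+ d ℚ.* (a ℚ.- c) ≡ (a ℚ.* b) ℚ.- (c ℚ.* d)
    *-sub = solve-∀ ℚ-ring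

    neg-close : ∀ x y {ε} → ∣ x ℚ.- y ∣ ℚ.< ε → ∣ ℚ.- x ℚ.- ℚ.- y ∣ ℚ.< ε
    neg-close x y p = ≡.subst (ℚ._< _)
      (≡.trans (≡.sym (ℚ.∣-p∣≡∣p∣ (x ℚ.- y))) (≡.cong ∣_∣ (neg-sub x y))) p

    swap-close : ∀ x y {ε} → ∣ x ℚ.- y ∣ ℚ.< ε → ∣ y ℚ.- x ∣ ℚ.< ε
    swap-close x y p = ≡.subst (ℚ._< _)
      (≡.trans (≡.sym (ℚ.∣-p∣≡∣p∣ (x ℚ.- y))) (≡.cong ∣_∣ (swap-sub x y))) p

    sum-close : ∀ a b c d {δ ε} → ∣ a ℚ.- c ∣ ℚ.< δ → ∣ b ℚ.- d ∣ ℚ.< δ → δ ℚ.+ δ ≡ ε →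
                ∣ (a ℚ.+ b) ℚ.- (c ℚ.+ d) ∣ ℚ.< ε
    sum-close a b c d p q e = ≡.subst (λ z → ∣ z ∣ ℚ.< _) (+-sub a b c d)
      (+-close (a ℚ.- c) (b ℚ.- d) p q e)

    ∣p∣-nonNeg : ∀ p → 0ℚ ℚ.≤ ∣ p ∣
    ∣p∣-nonNeg p = ℚ.nonNegative⁻¹ ∣ p ∣ {{ℚ.∣-∣-nonNeg p}}

    ∣*∣-close : ∀ p q {B δ} → ∣ p ∣ ℚ.< B → ∣ q ∣ ℚ.< δ → ∣ p ℚ.* q ∣ ℚ.< B ℚ.* δ
    ∣*∣-close p q {B} {δ} p< q< = ≡.subst (ℚ._< B ℚ.* δ) (≡.sym (ℚ.∣p*q∣≡∣p∣*∣q∣ p q))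
      (ℚ.≤-<-trans
        (ℚ.*-monoʳ-≤-nonNeg ∣ q ∣ {{ℚ.∣-∣-nonNeg q}} (ℚ.<⇒≤ p<))
        (ℚ.*-monoʳ-<-pos B {{ℚ.positive (ℚ.≤-<-trans (∣p∣-nonNeg p) p<)}} q<))

    bound : ∀ (x : ℝ) → ∃ λ B → 0ℚ ℚ.< B × ∃ λ N → ∀ n → N ℕ.≤ n → ∣ seq x n ∣ ℚ.< B
    bound x with cauchy x 1ℚ (ℚ.positive⁻¹ 1ℚ)
    ... | N , close = B , B>0 , N , λ n N≤n →
          ≡.subst (λ z → ∣ z ∣ ℚ.< B) (cancel (seq x n) (seq x N))
            (ℚ.≤-<-trans (ℚ.∣p+q∣≤∣p∣+∣q∣ (seq x n ℚ.- seq x N) (seq x N))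
              (ℚ.+-mono-<-≤ (close n N N≤n ℕ.≤-refl) ℚ.≤-refl))
      where
      B = 1ℚ ℚ.+ ∣ seq x N ∣
      B>0 : 0ℚ ℚ.< B
      B>0 = ℚ.+-mono-<-≤ (ℚ.positive⁻¹ 1ℚ) (∣p∣-nonNeg (seq x N))
      cancel : ∀ p q → (p ℚ.- q) ℚ.+ q ≡ p
      cancel = solve-∀ ℚ-ring

    scale : ∀ {A D} ε → 0ℚ ℚ.< A → 0ℚ ℚ.< D → 0ℚ ℚ.< ε →
            ∃ λ δ → 0ℚ ℚ.< δ × A ℚ.* δ ℚ.+ D ℚ.* δ ≡ ε
    scale {A} {D} ε A>0 D>0 ε>0 = δ , ℚ.positive⁻¹ δ {{δ-pos}} , eq
      where
      instance
        S-pos : Positive (A ℚ.+ D)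
        S-pos = ℚ.positive (ℚ.+-mono-< A>0 D>0)
        S≢0 : ℚ.NonZero (A ℚ.+ D)
        S≢0 = ℚ.pos⇒nonZero (A ℚ.+ D)
      δ = 1/ (A ℚ.+ D) ℚ.* ε
      δ-pos : Positive δ
      δ-pos = ℚ.pos*pos⇒pos (1/ (A ℚ.+ D)) {{ℚ.1/pos⇒pos (A ℚ.+ D)}} ε {{ℚ.positive ε>0}}
      open ≡.≡-Reasoning
      eq : A ℚ.* δ ℚ.+ D ℚ.* δ ≡ ε
      eq = begin
        A ℚ.* δ ℚ.+ D ℚ.* δ                    ≡⟨ ℚ.*-distribʳ-+ δ A D ⟨
        (A ℚ.+ D) ℚ.* (1/ (A ℚ.+ D) ℚ.* ε)     ≡⟨ ℚ.*-assoc (A ℚ.+ D) (1/ (A ℚ.+ D)) ε ⟨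
        (A ℚ.+ D) ℚ.* 1/ (A ℚ.+ D) ℚ.* ε       ≡⟨ ≡.cong (ℚ._* ε) (ℚ.*-inverseʳ (A ℚ.+ D)) ⟩
        1ℚ ℚ.* ε                               ≡⟨ ℚ.*-identityˡ ε ⟩
        ε                                      ∎

    prod-close : ∀ a b c d {A D δ ε} → ∣ a ∣ ℚ.< A → ∣ d ∣ ℚ.< D →
                 ∣ a ℚ.- c ∣ ℚ.< δ → ∣ b ℚ.- d ∣ ℚ.< δ → A ℚ.* δ ℚ.+ D ℚ.* δ ≡ ε →
                 ∣ (a ℚ.* b) ℚ.- (c ℚ.* d) ∣ ℚ.< ε
    prod-close a b c d a< d< p q e = ≡.subst (λ z → ∣ z ∣ ℚ.< _) (*-sub a b c d)
      (+-close (a ℚ.* (b ℚ.- d)) (d ℚ.* (a ℚ.- c))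
        (∣*∣-close a (b ℚ.- d) a< q) (∣*∣-close d (a ℚ.- c) d< p) e)

    ⊔ˡ : ∀ {k} m n → m ℕ.⊔ n ℕ.≤ k → m ℕ.≤ k
    ⊔ˡ m n = ℕ.m⊔n≤o⇒m≤o m n

    ⊔ʳ : ∀ {k} m n → m ℕ.⊔ n ℕ.≤ k → n ℕ.≤ k
    ⊔ʳ m n = ℕ.m⊔n≤o⇒n≤o m n

  fromℚ : ℚ → ℝ
  fromℚ q = mkℝ (λ _ → q) λ ε ε>0 → 0 , λ _ _ _ _ → ∣x-x∣<ε q ε>0

  infixl 6 _+_
  infixl 7 _*_
  infix  8 -_

  -- Abstract, so that η-conversion on ℝ does not unfold these proofs.
  private abstract
    +-cauchy : ∀ x y → IsCauchy λ n → seq x n ℚ.+ seq y n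
    +-cauchy x y ε ε>0 =
      let δ , δ>0 , e = halve ε ε>0
          M , p = cauchy x δ δ>0
          N , q = cauchy y δ δ>0
      in M ℕ.⊔ N , λ m n m≥ n≥ →
         sum-close (seq x m) (seq y m) (seq x n) (seq y n)
           (p m n (⊔ˡ M N m≥) (⊔ˡ M N n≥)) (q m n (⊔ʳ M N m≥) (⊔ʳ M N n≥)) e

    -‿cauchy : ∀ x → IsCauchy λ n → ℚ.- seq x n
    -‿cauchy x ε ε>0 =
      let N , p = cauchy x ε ε>0
      in N , λ m n m≥ n≥ → neg-close (seq x m) (seq x n) (p m n m≥ n≥)

    *-cauchy : ∀ x y → IsCauchy λ n → seq x n ℚ.* seq y n
    *-cauchy x y ε ε>0 =
      let A , A>0 , K , a< = bound x
          D , D>0 , L , d< = bound y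
          δ , δ>0 , e = scale ε A>0 D>0 ε>0
          M , p = cauchy x δ δ>0
          N , q = cauchy y δ δ>0
      in (K ℕ.⊔ L) ℕ.⊔ (M ℕ.⊔ N) , λ m n m≥ n≥ →
         let KLm = ⊔ˡ (K ℕ.⊔ L) (M ℕ.⊔ N) m≥ ; MNm = ⊔ʳ (K ℕ.⊔ L) (M ℕ.⊔ N) m≥
             KLn = ⊔ˡ (K ℕ.⊔ L) (M ℕ.⊔ N) n≥ ; MNn = ⊔ʳ (K ℕ.⊔ L) (M ℕ.⊔ N) n≥ in
         prod-close (seq x m) (seq y m) (seq x n) (seq y n)
           (a< m (⊔ˡ K L KLm)) (d< n (⊔ʳ K L KLn))
           (p m n (⊔ˡ M N MNm) (⊔ˡ M N MNn)) (q m n (⊔ʳ M N MNm) (⊔ʳ M N MNn)) e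

  _+_ : ℝ → ℝ → ℝ
  x + y = mkℝ (λ n → seq x n ℚ.+ seq y n) (+-cauchy x y)

  -_ : ℝ → ℝ
  - x = mkℝ (λ n → ℚ.- seq x n) (-‿cauchy x)

  _*_ : ℝ → ℝ → ℝ
  x * y = mkℝ (λ n → seq x n ℚ.* seq y n) (*-cauchy x y)

  pointwise : ∀ {x y} → (∀ n → seq x n ≡ seq y n) → x ≃ y
  pointwise {x} {y} eq = mk≃ λ ε ε>0 → 0 , λ n _ →
    ≡.subst (λ z → ∣ seq x n ℚ.- z ∣ ℚ.< ε) (eq n) (∣x-x∣<ε (seq x n) ε>0)

  private
    ≃-refl : Reflexive _≃_
    ≃-refl = pointwise λ _ → ≡.refl

    ≃-sym : Symmetric _≃_
    ≃-sym {x} {y} (mk≃ p) = mk≃ λ ε ε>0 → let N , q = p ε ε>0 in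
      N , λ n n≥ → swap-close (seq x n) (seq y n) (q n n≥)

    ≃-trans : Transitive _≃_
    ≃-trans {x} {y} {z} (mk≃ p) (mk≃ q) = mk≃ λ ε ε>0 →
      let δ , δ>0 , e = halve ε ε>0
          M , p′ = p δ δ>0
          N , q′ = q δ δ>0
      in M ℕ.⊔ N , λ n n≥ →
         ≡.subst (λ w → ∣ w ∣ ℚ.< ε) (split-sub (seq x n) (seq y n) (seq z n))
           (+-close (seq x n ℚ.- seq y n) (seq y n ℚ.- seq z n)
             (p′ n (⊔ˡ M N n≥)) (q′ n (⊔ʳ M N n≥)) e)

    +-cong : ∀ {x x′ y y′} → x ≃ x′ → y ≃ y′ → x + y ≃ x′ + y′
    +-cong {x} {x′} {y} {y′} (mk≃ p) (mk≃ q) = mk≃ λ ε ε>0 →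
      let δ , δ>0 , e = halve ε ε>0
          M , p′ = p δ δ>0
          N , q′ = q δ δ>0
      in M ℕ.⊔ N , λ n n≥ →
         sum-close (seq x n) (seq y n) (seq x′ n) (seq y′ n)
           (p′ n (⊔ˡ M N n≥)) (q′ n (⊔ʳ M N n≥)) e

    -‿cong : ∀ {x y} → x ≃ y → - x ≃ - y
    -‿cong {x} {y} (mk≃ p) = mk≃ λ ε ε>0 → let N , q = p ε ε>0 in
      N , λ n n≥ → neg-close (seq x n) (seq y n) (q n n≥)

    *-cong : ∀ {x x′ y y′} → x ≃ x′ → y ≃ y′ → x * y ≃ x′ * y′
    *-cong {x} {x′} {y} {y′} (mk≃ p) (mk≃ q) = mk≃ λ ε ε>0 →
      let A , A>0 , K , a< = bound x
          D , D>0 , L , d< = bound y′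
          δ , δ>0 , e = scale ε A>0 D>0 ε>0
          M , p′ = p δ δ>0
          N , q′ = q δ δ>0
      in (K ℕ.⊔ L) ℕ.⊔ (M ℕ.⊔ N) , λ n n≥ →
         let KL = ⊔ˡ (K ℕ.⊔ L) (M ℕ.⊔ N) n≥ ; MN = ⊔ʳ (K ℕ.⊔ L) (M ℕ.⊔ N) n≥ in
         prod-close (seq x n) (seq y n) (seq x′ n) (seq y′ n)
           (a< n (⊔ˡ K L KL)) (d< n (⊔ʳ K L KL)) (p′ n (⊔ˡ M N MN)) (q′ n (⊔ʳ M N MN)) e

    0ℝ 1ℝ : ℝ
    0ℝ = fromℚ 0ℚ
    1ℝ = fromℚ 1ℚ

    +-assoc : ∀ x y z → (x + y) + z ≃ x + (y + z)
    +-assoc x y z = pointwise λ n → ℚ.+-assoc (seq x n) (seq y n) (seq z n)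

    +-comm : ∀ x y → x + y ≃ y + x
    +-comm x y = pointwise λ n → ℚ.+-comm (seq x n) (seq y n)

    +-identityˡ : ∀ x → 0ℝ + x ≃ x
    +-identityˡ x = pointwise λ n → ℚ.+-identityˡ (seq x n)

    -‿inverseˡ : ∀ x → - x + x ≃ 0ℝ
    -‿inverseˡ x = pointwise λ n → ℚ.+-inverseˡ (seq x n)

    *-assoc : ∀ x y z → (x * y) * z ≃ x * (y * z)
    *-assoc x y z = pointwise λ n → ℚ.*-assoc (seq x n) (seq y n) (seq z n)

    *-comm : ∀ x y → x * y ≃ y * x
    *-comm x y = pointwise λ n → ℚ.*-comm (seq x n) (seq y n)

    *-identityˡ : ∀ x → 1ℝ * x ≃ x
    *-identityˡ x = pointwise λ n → ℚ.*-identityˡ (seq x n)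

    *-distribˡ-+ : ∀ x y z → x * (y + z) ≃ x * y + x * z
    *-distribˡ-+ x y z = pointwise λ n → ℚ.*-distribˡ-+ (seq x n) (seq y n) (seq z n)

  ℝ-commutativeRing : CommutativeRing 0ℓ 0ℓ
  ℝ-commutativeRing = record
    { Carrier = ℝ ; _≈_ = _≃_ ; _+_ = _+_ ; _*_ = _*_ ; -_ = -_ ; 0# = 0ℝ ; 1# = 1ℝ
    ; isCommutativeRing = record
      { isRing = record
        { +-isAbelianGroup = record
          { isGroup = record
            { isMonoid = record
              { isSemigroup = record
                { isMagma = record
                  { isEquivalence = record { refl = ≃-refl ; sym = ≃-sym ; trans = ≃-trans }
                  ; ∙-cong = +-cong }
                ; assoc = +-assoc }
              ; identity = +-identityˡ , λ x → ≃-trans (+-comm x 0ℝ) (+-identityˡ x) }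
            ; inverse = -‿inverseˡ , λ x → ≃-trans (+-comm x (- x)) (-‿inverseˡ x)
            ; ⁻¹-cong = -‿cong }
          ; comm = +-comm }
        ; *-cong = *-cong
        ; *-assoc = *-assoc
        ; *-identity = *-identityˡ , λ x → ≃-trans (*-comm x 1ℝ) (*-identityˡ x)
        ; distrib = *-distribˡ-+ , λ x y z → ≃-trans (*-comm (y + z) x)
            (≃-trans (*-distribˡ-+ x y z) (+-cong (*-comm x y) (*-comm x z))) }
      ; *-comm = *-comm } }

module Complex where

  private
    open Real using (ℝ; seq; pointwise)
    module R = CommutativeRing Real.ℝ-commutativeRing

  infix 5 _+i_

  record ℂ : Set where
    constructor _+i_
    field
      re im : ℝ

  open ℂ public

  infix 4 _≃_

  record _≃_ (z w : ℂ) : Set where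
    constructor _,_
    field
      re-≈ : re z R.≈ re w
      im-≈ : im z R.≈ im w

  infixl 6 _+_
  infixl 7 _*_
  infix  8 -_

  _+_ _*_ : ℂ → ℂ → ℂ
  (a +i b) + (x +i y) = (a R.+ x) +i (b R.+ y)
  (a +i b) * (x +i y) = (a R.* x R.- b R.* y) +i (a R.* y R.+ b R.* x)

  -_ : ℂ → ℂ
  - (a +i b) = (R.- a) +i (R.- b)

  private
    0ℂ 1ℂ : ℂ
    0ℂ = R.0# +i R.0#
    1ℂ = R.1# +i R.0#

    *-assoc-re : ∀ a b x y u v →
      (a ℚ.* x ℚ.- b ℚ.* y) ℚ.* u ℚ.- (a ℚ.* y ℚ.+ b ℚ.* x) ℚ.* v ≡
      a ℚ.* (x ℚ.* u ℚ.- y ℚ.* v) ℚ.- b ℚ.* (x ℚ.* v ℚ.+ y ℚ.* u)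
    *-assoc-re = solve-∀ ℚ-ring

    *-assoc-im : ∀ a b x y u v →
      (a ℚ.* x ℚ.- b ℚ.* y) ℚ.* v ℚ.+ (a ℚ.* y ℚ.+ b ℚ.* x) ℚ.* u ≡
      a ℚ.* (x ℚ.* v ℚ.+ y ℚ.* u) ℚ.+ b ℚ.* (x ℚ.* u ℚ.- y ℚ.* v)
    *-assoc-im = solve-∀ ℚ-ring

    *-comm-re : ∀ a b x y → a ℚ.* x ℚ.- b ℚ.* y ≡ x ℚ.* a ℚ.- y ℚ.* b
    *-comm-re = solve-∀ ℚ-ring

    *-comm-im : ∀ a b x y → a ℚ.* y ℚ.+ b ℚ.* x ≡ x ℚ.* b ℚ.+ y ℚ.* a
    *-comm-im = solve-∀ ℚ-ring

    1-re : ∀ a b → 1ℚ ℚ.* a ℚ.- 0ℚ ℚ.* b ≡ a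
    1-re = solve-∀ ℚ-ring

    1-im : ∀ a b → 1ℚ ℚ.* b ℚ.+ 0ℚ ℚ.* a ≡ b
    1-im = solve-∀ ℚ-ring

    distrib-re : ∀ a b x y u v →
      a ℚ.* (x ℚ.+ u) ℚ.- b ℚ.* (y ℚ.+ v) ≡
      (a ℚ.* x ℚ.- b ℚ.* y) ℚ.+ (a ℚ.* u ℚ.- b ℚ.* v)
    distrib-re = solve-∀ ℚ-ring

    distrib-im : ∀ a b x y u v →
      a ℚ.* (y ℚ.+ v) ℚ.+ b ℚ.* (x ℚ.+ u) ≡
      (a ℚ.* y ℚ.+ b ℚ.* x) ℚ.+ (a ℚ.* v ℚ.+ b ℚ.* u)
    distrib-im = solve-∀ ℚ-ring

    ≃-trans : Transitive _≃_
    ≃-trans (p , q) (r , s) = R.trans p r , R.trans q s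

    +-cong : ∀ {x x′ y y′} → x ≃ x′ → y ≃ y′ → x + y ≃ x′ + y′
    +-cong (p , q) (r , s) = R.+-cong p r , R.+-cong q s

    *-cong : ∀ {x x′ y y′} → x ≃ x′ → y ≃ y′ → x * y ≃ x′ * y′
    *-cong (p , q) (r , s) =
      R.+-cong (R.*-cong p r) (R.-‿cong (R.*-cong q s)) ,
      R.+-cong (R.*-cong p s) (R.*-cong q r)

    *-comm : ∀ x y → x * y ≃ y * x
    *-comm (a +i b) (x +i y) =
      pointwise (λ n → *-comm-re (seq a n) (seq b n) (seq x n) (seq y n)) ,
      pointwise (λ n → *-comm-im (seq a n) (seq b n) (seq x n) (seq y n))

    *-identityˡ : ∀ x → 1ℂ * x ≃ x
    *-identityˡ (a +i b) =
      pointwise (λ n → 1-re (seq a n) (seq b n)) ,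
      pointwise (λ n → 1-im (seq a n) (seq b n))

    *-distribˡ-+ : ∀ x y z → x * (y + z) ≃ x * y + x * z
    *-distribˡ-+ (a +i b) (x +i y) (u +i v) =
      pointwise (λ n → distrib-re (seq a n) (seq b n) (seq x n) (seq y n) (seq u n) (seq v n)) ,
      pointwise (λ n → distrib-im (seq a n) (seq b n) (seq x n) (seq y n) (seq u n) (seq v n))

    *-assoc : ∀ x y z → (x * y) * z ≃ x * (y * z)
    *-assoc (a +i b) (x +i y) (u +i v) =
      pointwise (λ n → *-assoc-re (seq a n) (seq b n) (seq x n) (seq y n) (seq u n) (seq v n)) ,
      pointwise (λ n → *-assoc-im (seq a n) (seq b n) (seq x n) (seq y n) (seq u n) (seq v n))

    +-assoc : ∀ x y z → (x + y) + z ≃ x + (y + z)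
    +-assoc (a +i b) (x +i y) (u +i v) = R.+-assoc a x u , R.+-assoc b y v

    +-comm : ∀ x y → x + y ≃ y + x
    +-comm (a +i b) (x +i y) = R.+-comm a x , R.+-comm b y

    +-identityˡ : ∀ x → 0ℂ + x ≃ x
    +-identityˡ (a +i b) = R.+-identityˡ a , R.+-identityˡ b

    -‿inverseˡ : ∀ x → - x + x ≃ 0ℂ
    -‿inverseˡ (a +i b) = R.-‿inverseˡ a , R.-‿inverseˡ b

  ℂ-commutativeRing : CommutativeRing 0ℓ 0ℓ
  ℂ-commutativeRing = record
    { Carrier = ℂ ; _≈_ = _≃_ ; _+_ = _+_ ; _*_ = _*_ ; -_ = -_ ; 0# = 0ℂ ; 1# = 1ℂ
    ; isCommutativeRing = record
      { isRing = record
        { +-isAbelianGroup = record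
          { isGroup = record
            { isMonoid = record
              { isSemigroup = record
                { isMagma = record
                  { isEquivalence = record
                    { refl = R.refl , R.refl
                    ; sym = λ (p , q) → R.sym p , R.sym q
                    ; trans = ≃-trans }
                  ; ∙-cong = +-cong }
                ; assoc = +-assoc }
              ; identity = +-identityˡ , λ x → ≃-trans (+-comm x 0ℂ) (+-identityˡ x) }
            ; inverse = -‿inverseˡ , λ x → ≃-trans (+-comm x (- x)) (-‿inverseˡ x)
            ; ⁻¹-cong = λ (p , q) → R.-‿cong p , R.-‿cong q }
          ; comm = +-comm }
        ; *-cong = *-cong
        ; *-assoc = *-assoc
        ; *-identity = *-identityˡ , λ x → ≃-trans (*-comm x 1ℂ) (*-identityˡ x)
        ; distrib = *-distribˡ-+ , λ x y z → ≃-trans (*-comm (y + z) x)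
            (≃-trans (*-distribˡ-+ x y z) (+-cong (*-comm x y) (*-comm x z))) }
      ; *-comm = *-comm } }

module Matrices {c ℓ} (R : CommutativeRing c ℓ) where

  open CommutativeRing R hiding (zero)
  open Sum +-commutativeMonoid using (sum)
  open Exp semiring using (_^_)

  Matrix : ℕ → Set c
  Matrix n = Fin n → Fin n → Carrier

  infix 4 _≈ᴹ_

  _≈ᴹ_ : ∀ {n} → Matrix n → Matrix n → Set ℓ
  A ≈ᴹ B = ∀ i j → A i j ≈ B i j

  O I : ∀ {n} → Matrix n
  O i j = 0#
  I i j = if ⌊ i Fin.≟ j ⌋ then 1# else 0#

  infixl 6 _-ᴹ_
  infixl 7 _*ᴹ_

  _-ᴹ_ _*ᴹ_ : ∀ {n} → Matrix n → Matrix n → Matrix n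
  (A -ᴹ B) i j = A i j - B i j
  (A *ᴹ B) i j = sum λ k → A i k * B k j

  InGL : ∀ {n} → Matrix n → Set (c ⊔ ℓ)
  InGL = Invertible _≈ᴹ_ I _*ᴹ_

  minor : ∀ {n} → Fin (suc n) → Fin (suc n) → Matrix (suc n) → Matrix n
  minor i j A r s = A (punchIn i r) (punchIn j s)

  -- Laplace expansion along the first row.
  det : ∀ {n} → Matrix n → Carrier
  det {zero}  A = 1#
  det {suc n} A = sum λ j → (- 1#) ^ toℕ j * A zero j * det (minor zero j A)

  -- Families of blocks are indexed from 1: the value a 0 is never used.
  module _ {l : ℕ} (a : ℕ → Matrix l) where

    -- 𝔭₋₁ k is the polynomial of index k - 1, so that the recursion can start
    -- from index -1.
    𝔭₋₁ : ℕ → Matrix l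
    𝔭₋₁ zero          = O
    𝔭₋₁ (suc zero)    = I
    𝔭₋₁ (suc (suc k)) = a (suc k) *ᴹ 𝔭₋₁ (suc k) -ᴹ 𝔭₋₁ k

    𝔭 : ℕ → Matrix l
    𝔭 m = 𝔭₋₁ (suc m)

    -- Rows and columns are counted from 0, so the diagonal blocks are
    -- a m , … , a 1.
    block : ∀ m → Fin m → Fin m → Matrix l
    block m i j =
      if ⌊ i Fin.≟ j ⌋ then a (m ℕ.∸ toℕ i)
      else if ⌊ (suc (toℕ i) ℕ.≟ toℕ j) ⊎-dec (suc (toℕ j) ℕ.≟ toℕ i) ⌋ then I
      else O

    𝔔 : ∀ m → Matrix (m ℕ.* l)
    𝔔 m r s = block m (quotient l r) (quotient l s) (remainder {m} l r) (remainder {m} l s)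

open Complex public using (ℂ; ℂ-commutativeRing) renaming (_≃_ to _≈ℂ_)
open Matrices ℂ-commutativeRing public

{-# OPTIONS --safe #-}
-- Let D k X Y be the determinant of 𝔔 (k + 1) with its first block row replaced by
-- (X , Y , O , … , O). Since the block below X is I, eliminating the first block column
-- gives D (k + 1) X Y = D k (X a_{k+1} - Y) X. The recursion of 𝔭 makes the matrix
-- X 𝔭_k - Y 𝔭_{k-1} invariant under this step, and for k = 0 it is X, so its determinant
-- is D k X Y. Taking X = a_m, Y = I and k = m - 1 gives 𝔔_m on one side and 𝔭_m on the other.

module Submission where

open import Algebra.Bundles using (CommutativeRing)
import Algebra.Properties.Ring as RingProperties
import Algebra.Properties.Semiring.Exp as Exp
import Algebra.Properties.Semiring.Sum as Sum
import Algebra.Solver.Ring.NaturalCoefficients.Default as SemiringSolver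
open import Data.Bool.Base using (if_then_else_)
open import Data.Empty using (⊥-elim)
open import Data.Fin.Base
  using (Fin; zero; suc; toℕ; punchIn; combine; quotient; remainder; _↑ˡ_; _↑ʳ_)
import Data.Fin.Properties as Fin
open import Data.Nat.Base as ℕ using (ℕ; zero; suc; _≤_)
import Data.Nat.Properties as ℕ
open import Data.Product.Base using (_×_; _,_; proj₁; proj₂)
open import Data.Vec.Functional using (Vector; _∷_; updateAt)
open import Data.Vec.Functional.Properties using (updateAt-updates; updateAt-minimal)
open import Function.Base using (_∘_; const)
open import Relation.Binary.PropositionalEquality as ≡ using (_≡_; _≢_)
import Relation.Binary.Reasoning.Setoid as SetoidReasoning
open import Relation.Nullary.Decidable using (Dec; does; yes; no; isYes≗does; ⌊_⌋; _⊎-dec_)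
open import Defs using (module Matrices)

-- Every index of a product is `combine` of its quotient and its remainder, so entries of a
-- flattened matrix can be treated by block index and inner index.
combine-elim : ∀ {p m l} (P : Fin (m ℕ.* l) → Set p) →
               (∀ (i : Fin m) (r : Fin l) → P (combine i r)) → ∀ s → P s
combine-elim {m = m} {l} P f s = ≡.subst P (Fin.combine-remQuot {m} l s)
  (f (quotient l s) (remainder {m} l s))

module Determinants {c ℓ} (R : CommutativeRing c ℓ) where

  open CommutativeRing R hiding (zero)
  open RingProperties ring
  open Exp semiring using (_^_)
  open Sum semiring using
    (sum; sum-cong-≋; sum-replicate-zero; ∑-distrib-+; ∑-comm; *-distribˡ-sum; *-distribʳ-sum)
  open SemiringSolver commutativeSemiring using (solve; _:+_; _:*_; _:=_)
  open SetoidReasoning setoid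
  open Matrices R

  -- Ring identities and finite sums

  private
    expand₁ : ∀ s a b x d → s * (a + x * b) * d ≈ s * a * d + x * (s * b * d)
    expand₁ = solve 5 (λ s a b x d → s :* (a :+ x :* b) :* d := s :* a :* d :+ x :* (s :* b :* d)) refl

    expand₂ : ∀ y d e x → y * (d + x * e) ≈ y * d + x * (y * e)
    expand₂ = solve 4 (λ y d e x → y :* (d :+ x :* e) := y :* d :+ x :* (y :* e)) refl

    -- Here `e` is to be `- 1#`, the factor that distinguishes `sign (suc j)` from `sign j`. It
    -- passes from the column index to the row index when the order of expansion is exchanged.
    exchange : ∀ e s a t b d → e * s * a * (t * b * d) ≈ e * t * b * (s * a * d)
    exchange = solve 6 (λ e s a t b d → e :* s :* a :* (t :* b :* d) := e :* t :* b :* (s :* a :* d)) refl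

  sign : ∀ {n} → Fin n → Carrier
  sign i = (- 1#) ^ toℕ i

  sum-zero : ∀ {n} {f : Vector Carrier n} → (∀ i → f i ≈ 0#) → sum f ≈ 0#
  sum-zero {n} f≈0 = trans (sum-cong-≋ f≈0) (sum-replicate-zero n)

  sum-neg : ∀ {n} (f : Vector Carrier n) → sum (λ i → - f i) ≈ - sum f
  sum-neg f = begin
    sum (λ i → - f i)      ≈⟨ sum-cong-≋ (λ i → sym (-1*x≈-x (f i))) ⟩
    sum (λ i → - 1# * f i) ≈⟨ *-distribˡ-sum (- 1#) f ⟨
    - 1# * sum f           ≈⟨ -1*x≈-x _ ⟩
    - sum f                ∎

  sum-sub : ∀ {n} (f g : Vector Carrier n) → sum (λ i → f i - g i) ≈ sum f - sum g
  sum-sub f g = trans (∑-distrib-+ f (λ i → - g i)) (+-congˡ (sum-neg g))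

  x-0≈x : ∀ {x y} → y ≈ 0# → x - y ≈ x
  x-0≈x {x} y≈0 = trans (+-congˡ (trans (-‿cong y≈0) -0#≈0#)) (+-identityʳ x)

  *-vanishʳ : ∀ x {y} → y ≈ 0# → x * y ≈ 0#
  *-vanishʳ x y≈0 = trans (*-congˡ y≈0) (zeroʳ x)

  -- Linearity in a row and expansion along the first column

  det-cong : ∀ {n} {A B : Matrix n} → A ≈ᴹ B → det A ≈ det B
  det-cong {zero}  A≈B = refl
  det-cong {suc n} {A} {B} A≈B = sum-cong-≋ λ j →
    *-cong (*-congˡ {sign j} (A≈B zero j))
           (det-cong {A = minor zero j A} {minor zero j B} λ r s → A≈B (suc r) (punchIn j s))

  -- In the first row the expansion is linear in its coefficients and the minors coincide; in a
  -- later row the coefficients coincide and the minors are linear by induction. Relating three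
  -- matrices by hypotheses, instead of replacing a row in one matrix, lets the hypotheses pass to
  -- minors.
  det-row-linear : ∀ {n} (i : Fin n) x {A B C : Matrix n} →
    (∀ s → C i s ≈ A i s + x * B i s) →
    (∀ r → r ≢ i → ∀ s → A r s ≈ C r s) →
    (∀ r → r ≢ i → ∀ s → B r s ≈ C r s) →
    det C ≈ det A + x * det B
  det-row-linear {suc n} i x {A} {B} {C} Ci Ar Br = begin
    det C                                  ≈⟨ sum-cong-≋ (term i Ci Ar Br) ⟩
    sum (λ j → t A j + x * t B j)          ≈⟨ ∑-distrib-+ (t A) (λ j → x * t B j) ⟩
    det A + sum (λ j → x * t B j)          ≈⟨ +-congˡ (*-distribˡ-sum x (t B)) ⟨
    det A + x * det B                      ∎
    where
    t : Matrix (suc n) → Fin (suc n) → Carrier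
    t M j = sign j * M zero j * det (minor zero j M)
    term : ∀ i → (∀ s → C i s ≈ A i s + x * B i s) →
      (∀ r → r ≢ i → ∀ s → A r s ≈ C r s) →
      (∀ r → r ≢ i → ∀ s → B r s ≈ C r s) →
      ∀ j → t C j ≈ t A j + x * t B j
    term zero Ci Ar Br j = begin
      sign j * C zero j * det (minor zero j C)
        ≈⟨ *-congʳ (*-congˡ (Ci j)) ⟩
      sign j * (A zero j + x * B zero j) * det (minor zero j C)
        ≈⟨ expand₁ (sign j) (A zero j) (B zero j) x (det (minor zero j C)) ⟩
      sign j * A zero j * det (minor zero j C) + x * (sign j * B zero j * det (minor zero j C))
        ≈⟨ +-cong (*-congˡ (det-cong λ r s → sym (Ar (suc r) (λ ()) _)))
                  (*-congˡ (*-congˡ (det-cong λ r s → sym (Br (suc r) (λ ()) _)))) ⟩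
      t A j + x * t B j ∎
    term (suc i) Ci Ar Br j = begin
      sign j * C zero j * det (minor zero j C)
        ≈⟨ *-congˡ (det-row-linear i x (λ s → Ci _)
             (λ r r≢i s → Ar (suc r) (r≢i ∘ Fin.suc-injective) _)
             (λ r r≢i s → Br (suc r) (r≢i ∘ Fin.suc-injective) _)) ⟩
      sign j * C zero j * (det (minor zero j A) + x * det (minor zero j B))
        ≈⟨ expand₂ (sign j * C zero j) (det (minor zero j A)) (det (minor zero j B)) x ⟩
      sign j * C zero j * det (minor zero j A) + x * (sign j * C zero j * det (minor zero j B))
        ≈⟨ +-cong (*-congʳ (*-congˡ (sym (Ar zero (λ ()) j))))
                  (*-congˡ (*-congʳ (*-congˡ (sym (Br zero (λ ()) j))))) ⟩
      t A j + x * t B j ∎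

  -- Expanding the minors of the first row along their first column gives the same
  -- double sum as expanding the minors of the first column along their first row.
  det-column : ∀ {n} (A : Matrix (suc n)) →
    det A ≈ sum λ i → sign i * A i zero * det (minor i zero A)
  det-column {zero}  A = refl
  det-column {suc n} A = +-congˡ (begin
    sum (λ j → sign (suc j) * A zero (suc j) * det (minor zero (suc j) A))
      ≈⟨ sum-cong-≋ (λ j → *-congˡ {sign (suc j) * A zero (suc j)} (det-column (minor zero (suc j) A))) ⟩
    sum (λ j → sign (suc j) * A zero (suc j) * sum (λ i → u i * d i j))
      ≈⟨ sum-cong-≋ (λ j → *-distribˡ-sum (sign (suc j) * A zero (suc j)) (λ i → u i * d i j)) ⟩
    sum (λ j → sum (λ i → sign (suc j) * A zero (suc j) * (u i * d i j)))
      ≈⟨ ∑-comm (λ j i → sign (suc j) * A zero (suc j) * (u i * d i j)) ⟩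
    sum (λ i → sum (λ j → sign (suc j) * A zero (suc j) * (u i * d i j)))
      ≈⟨ sum-cong-≋ (λ i → sum-cong-≋ (λ j →
           exchange (- 1#) (sign j) (A zero (suc j)) (sign i) (A (suc i) zero) (d i j))) ⟩
    sum (λ i → sum (λ j → sign (suc i) * A (suc i) zero * (v j * d i j)))
      ≈⟨ sum-cong-≋ (λ i → *-distribˡ-sum (sign (suc i) * A (suc i) zero) (λ j → v j * d i j)) ⟨
    sum (λ i → sign (suc i) * A (suc i) zero * det (minor (suc i) zero A)) ∎)
    where
    u v : Fin (suc n) → Carrier
    u i = sign i * A (suc i) zero
    v j = sign j * A zero (suc j)
    d : Fin (suc n) → Fin (suc n) → Carrier
    d i j = det (minor i zero (minor zero (suc j) A))

  -- Row operations and the alternating property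

  -- The property is attached to one pair of rows so that row operations on that pair are available
  -- while the other pairs are still being proved.
  VanishesOnEqualRows : ∀ {n} → Fin n → Fin n → Set _
  VanishesOnEqualRows i j = ∀ A → (∀ s → A i s ≈ A j s) → det A ≈ 0#

  vanishes-sym : ∀ {n} {i j : Fin n} → VanishesOnEqualRows i j → VanishesOnEqualRows j i
  vanishes-sym vanishes A Aj≈Ai = vanishes A (sym ∘ Aj≈Ai)

  -- By linearity in row `i`, the two determinants differ by `x` times that of `A` with row `i`
  -- overwritten by row `j`, which has two equal rows.
  det-add-row : ∀ {n} {i j : Fin n} → VanishesOnEqualRows i j → i ≢ j →
    ∀ x {A B : Matrix n} →
    (∀ s → B i s ≈ A i s + x * A j s) → (∀ r → r ≢ i → ∀ s → A r s ≈ B r s) →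
    det A ≈ det B
  det-add-row {n} {i} {j} vanishes i≢j x {A} {B} Bi Br = sym (begin
    det B              ≈⟨ det-row-linear i x Bi′ Br A′r ⟩
    det A + x * det A′ ≈⟨ +-congˡ (trans (*-congˡ (vanishes A′ A′i≈A′j)) (zeroʳ x)) ⟩
    det A + 0#         ≈⟨ +-identityʳ _ ⟩
    det A              ∎)
    where
    A′ : Matrix n
    A′ = updateAt A i (const (A j))
    A′i : A′ i ≡ A j
    A′i = updateAt-updates i A
    A′≡A : ∀ r → r ≢ i → A′ r ≡ A r
    A′≡A r = updateAt-minimal r i A
    Bi′ : ∀ s → B i s ≈ A i s + x * A′ i s
    Bi′ s rewrite A′i = Bi s
    A′r : ∀ r → r ≢ i → ∀ s → A′ r s ≈ B r s
    A′r r r≢i s rewrite A′≡A r r≢i = Br r r≢i s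
    A′i≈A′j : ∀ s → A′ i s ≈ A′ j s
    A′i≈A′j s = reflexive (≡.cong-app (≡.trans A′i (≡.sym (A′≡A j (i≢j ∘ ≡.sym)))) s)

  -- Three row additions suffice: (u , v) becomes (u + v , v), then (u + v , - u), then (v , - u).
  det-turn-rows : ∀ {n} {i j : Fin n} → VanishesOnEqualRows i j → i ≢ j →
    ∀ {A B : Matrix n} →
    (∀ s → B i s ≈ A j s) → (∀ s → B j s ≈ - A i s) →
    (∀ r → r ≢ i → r ≢ j → ∀ s → A r s ≈ B r s) →
    det A ≈ det B
  det-turn-rows {n} {i} {j} vanishes i≢j {A} {B} Bi Bj Br = begin
    det A  ≈⟨ det-add-row vanishes i≢j 1#
                (λ s → reflexive (≡.cong-app A₁i s))
                (λ r r≢i s → reflexive (≡.sym (≡.cong-app (A₁≡A r r≢i) s))) ⟩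
    det A₁ ≈⟨ det-add-row (vanishes-sym {i = i} vanishes) j≢i (- 1#)
                (λ s → reflexive (≡.cong-app A₂j s))
                (λ r r≢j s → reflexive (≡.sym (≡.cong-app (A₂≡A₁ r r≢j) s))) ⟩
    det A₂ ≈⟨ det-add-row vanishes i≢j 1# Bi′ Br′ ⟩
    det B  ∎
    where
    j≢i : j ≢ i
    j≢i = i≢j ∘ ≡.sym
    A₁ A₂ : Matrix n
    A₁ = updateAt A i (λ _ s → A i s + 1# * A j s)
    A₂ = updateAt A₁ j (λ _ s → A₁ j s + - 1# * A₁ i s)
    A₁i : A₁ i ≡ λ s → A i s + 1# * A j s
    A₁i = updateAt-updates i A
    A₁≡A : ∀ r → r ≢ i → A₁ r ≡ A r
    A₁≡A r = updateAt-minimal r i A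
    A₂j : A₂ j ≡ λ s → A₁ j s + - 1# * A₁ i s
    A₂j = updateAt-updates j A₁
    A₂≡A₁ : ∀ r → r ≢ j → A₂ r ≡ A₁ r
    A₂≡A₁ r = updateAt-minimal r j A₁
    a-[b+a]≈-b : ∀ a b → a + - 1# * (b + 1# * a) ≈ - b
    a-[b+a]≈-b a b = begin
      a + - 1# * (b + 1# * a) ≈⟨ +-congˡ (-1*x≈-x _) ⟩
      a - (b + 1# * a)        ≈⟨ +-congˡ (-‿cong (+-congˡ (*-identityˡ a))) ⟩
      a - (b + a)             ≈⟨ +-congˡ (-‿+-comm b a) ⟨
      a + (- b - a)           ≈⟨ +-assoc a (- b) (- a) ⟨
      a + - b - a             ≈⟨ xyx⁻¹≈y a (- b) ⟩
      - b                     ∎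
    A₂j≈ : ∀ s → A₂ j s ≈ - A i s
    A₂j≈ s rewrite A₂j | A₁i | A₁≡A j j≢i = a-[b+a]≈-b (A j s) (A i s)
    Bi′ : ∀ s → B i s ≈ A₂ i s + 1# * A₂ j s
    Bi′ s = sym (begin
      A₂ i s + 1# * A₂ j s               ≈⟨ +-congˡ (trans (*-identityˡ _) (A₂j≈ s)) ⟩
      A₂ i s - A i s                     ≡⟨ ≡.cong (λ f → f s - A i s) (≡.trans (A₂≡A₁ i i≢j) A₁i) ⟩
      A i s + 1# * A j s - A i s         ≈⟨ xyx⁻¹≈y (A i s) (1# * A j s) ⟩
      1# * A j s                         ≈⟨ *-identityˡ _ ⟩
      A j s                              ≈⟨ Bi s ⟨
      B i s                              ∎)
    Br′ : ∀ r → r ≢ i → ∀ s → A₂ r s ≈ B r s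
    Br′ r r≢i s with r Fin.≟ j
    ... | yes ≡.refl = trans (A₂j≈ s) (sym (Bj s))
    ... | no r≢j     = trans
      (reflexive (≡.cong-app (≡.trans (A₂≡A₁ r r≢j) (A₁≡A r r≢i)) s)) (Br r r≢i r≢j s)

  -- In the expansion along the first column, the first two terms have equal entries, equal minors
  -- and opposite signs. Every other minor keeps the two equal rows on top and vanishes by induction
  -- on the size.
  first-two-vanish : ∀ {n} → VanishesOnEqualRows {suc (suc n)} zero (suc zero)
  first-two-vanish {n} A A₀≈A₁ = begin
    det A
      ≈⟨ det-column A ⟩
    t zero + (t (suc zero) + sum (λ i → t (suc (suc i))))
      ≈⟨ +-congˡ (+-cong t₁ (rest A A₀≈A₁)) ⟩
    t zero + (- t zero + 0#)
      ≈⟨ +-congˡ (+-identityʳ _) ⟩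
    t zero - t zero
      ≈⟨ -‿inverseʳ _ ⟩
    0# ∎
    where
    t : Fin (suc (suc n)) → Carrier
    t i = sign i * A i zero * det (minor i zero A)
    minors : minor (suc zero) zero A ≈ᴹ minor zero zero A
    minors zero    s = A₀≈A₁ _
    minors (suc r) s = refl
    t₁ : t (suc zero) ≈ - t zero
    t₁ = begin
      - 1# * 1# * A (suc zero) zero * det (minor (suc zero) zero A)
        ≈⟨ *-cong (*-congˡ (sym (A₀≈A₁ zero))) (det-cong minors) ⟩
      - 1# * 1# * A zero zero * det (minor zero zero A)
        ≈⟨ *-congʳ (*-assoc (- 1#) 1# (A zero zero)) ⟩
      - 1# * (1# * A zero zero) * det (minor zero zero A)
        ≈⟨ *-assoc (- 1#) (1# * A zero zero) _ ⟩
      - 1# * t zero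
        ≈⟨ -1*x≈-x _ ⟩
      - t zero ∎
    -- Splitting on the size shows that a minor either does not occur or again has at least two
    -- rows.
    rest : ∀ {n} (A : Matrix (suc (suc n))) → (∀ s → A zero s ≈ A (suc zero) s) →
      sum (λ i → sign (suc (suc i)) * A (suc (suc i)) zero * det (minor (suc (suc i)) zero A)) ≈ 0#
    rest {zero}  A A₀≈A₁ = refl
    rest {suc n} A A₀≈A₁ = sum-zero λ i →
      *-vanishʳ (sign (suc (suc i)) * A (suc (suc i)) zero)
        (first-two-vanish (minor (suc (suc i)) zero A) (λ s → A₀≈A₁ (suc s)))

  -- Moving row q to row 1, and minus row 1 to row q, reduces to the case of the first two rows.
  first-row-vanishes : ∀ {n} →
    (∀ {i j : Fin n} → i ≢ j → VanishesOnEqualRows (suc i) (suc j)) →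
    ∀ j → VanishesOnEqualRows {suc n} zero (suc j)
  first-row-vanishes vanishes zero        A A₀≈A₁ = first-two-vanish A A₀≈A₁
  first-row-vanishes {n} vanishes (suc j) A A₀≈Aq = begin
    det A ≈⟨ det-turn-rows (vanishes {zero} {suc j} (λ ())) (λ ()) {A} {B}
               (λ s → reflexive (≡.cong-app B₁ s))
               (λ s → reflexive (≡.cong-app (updateAt-updates q {λ _ s → - A (suc zero) s} A₁) s))
               (λ r r≢1 r≢q s → reflexive (≡.sym (≡.cong-app
                 (≡.trans (updateAt-minimal r q A₁ r≢q) (updateAt-minimal r (suc zero) A r≢1)) s))) ⟩
    det B ≈⟨ first-two-vanish B (λ s → trans (A₀≈Aq s) (reflexive (≡.sym (≡.cong-app B₁ s)))) ⟩
    0#    ∎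
    where
    q : Fin (suc n)
    q = suc (suc j)
    A₁ B : Matrix (suc n)
    A₁ = updateAt A (suc zero) (const (A q))
    B  = updateAt A₁ q (λ _ s → - A (suc zero) s)
    B₁ : B (suc zero) ≡ A q
    B₁ = ≡.refl

  -- Induction on the size. If both rows lie below the first, every minor in the Laplace expansion
  -- has two equal rows; this case in turn supplies the row operations for pairs that contain the
  -- first row.
  det-alternating : ∀ {n} {i j : Fin n} → i ≢ j → VanishesOnEqualRows i j
  det-alternating {suc n} {i} {j} = go i j
    where
    tail-vanishes : ∀ {i j : Fin n} → i ≢ j → VanishesOnEqualRows (suc i) (suc j)
    tail-vanishes i≢j A Ai≈Aj = sum-zero λ k →
      *-vanishʳ (sign k * A zero k)
        (det-alternating i≢j (minor zero k A) (λ s → Ai≈Aj (punchIn k s)))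
    go : ∀ i j → i ≢ j → VanishesOnEqualRows i j
    go zero    zero    i≢j = ⊥-elim (i≢j ≡.refl)
    go zero    (suc j) i≢j = first-row-vanishes tail-vanishes j
    go (suc i) zero    i≢j = vanishes-sym {i = zero} (first-row-vanishes tail-vanishes i)
    go (suc i) (suc j) i≢j = tail-vanishes (i≢j ∘ ≡.cong suc)

  -- Elimination and the Schur complement of an identity corner

  -- The entries are updated one after another, the updated head being absorbed into the function
  -- before the tail is treated. The congruence hypothesis stands in for function extensionality,
  -- since the vectors met on the way agree only pointwise.
  update-everywhere : ∀ {b} {B : Set b} {n} (F : Vector B n → Carrier) →
    (∀ {v w} → (∀ i → v i ≡ w i) → F v ≈ F w) →
    (g : Fin n → B → B) → (∀ i v → F v ≈ F (updateAt v i (g i))) →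
    ∀ v → F v ≈ F (λ i → g i (v i))
  update-everywhere {n = zero}  F F-cong g inv v = F-cong λ ()
  update-everywhere {n = suc n} F F-cong g inv v = begin
    F v                                ≈⟨ inv zero v ⟩
    F (updateAt v zero (g zero))       ≈⟨ F-cong (λ { zero → ≡.refl ; (suc i) → ≡.refl }) ⟩
    F (g zero (v zero) ∷ (v ∘ suc))    ≈⟨ update-everywhere
                                            (λ w → F (g zero (v zero) ∷ w))
                                            (λ eq → F-cong λ { zero → ≡.refl ; (suc i) → eq i })
                                            (g ∘ suc)
                                            (λ i w → trans (inv (suc i) (g zero (v zero) ∷ w))
                                              (F-cong λ { zero → ≡.refl ; (suc r) → ≡.refl }))
                                            (v ∘ suc) ⟩
    F (g zero (v zero) ∷ (λ i → g (suc i) (v (suc i))))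
                                       ≈⟨ F-cong (λ { zero → ≡.refl ; (suc i) → ≡.refl }) ⟩
    F (λ i → g i (v i))                ∎

  -- One round of Gaussian elimination: multiples of the first row clear the first column below the
  -- pivot, and expansion along that column leaves a single minor.
  det-pivot : ∀ {n} (A : Matrix (suc n)) → A zero zero ≈ 1# →
    det A ≈ det (λ i j → A (suc i) (suc j) - A (suc i) zero * A zero (suc j))
  det-pivot {n} A A₀₀≈1 = begin
    det A
      -- The second form exposes the lower rows as a vector on which `update-everywhere` can act.
      ≈⟨ det-cong {A = A} {A zero ∷ (A ∘ suc)} (λ { zero s → refl ; (suc r) s → refl }) ⟩
    det (A zero ∷ (A ∘ suc))
      ≈⟨ update-everywhere (λ v → det (A zero ∷ v))
           (λ {v} {w} eq → det-cong {A = A zero ∷ v} {A zero ∷ w}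
             λ { zero s → refl ; (suc r) s → reflexive (≡.cong-app (eq r) s) })
           g step (A ∘ suc) ⟩
    det B
      ≈⟨ det-column B ⟩
    1# * A zero zero * det (minor zero zero B) +
      sum (λ i → sign (suc i) * B (suc i) zero * det (minor (suc i) zero B))
      ≈⟨ +-cong (*-congʳ (trans (*-identityˡ _) A₀₀≈1)) (sum-zero λ i → trans
           (*-congʳ {det (minor (suc i) zero B)} (*-vanishʳ (sign (suc i)) (cleared i))) (zeroˡ _)) ⟩
    1# * det (minor zero zero B) + 0#
      ≈⟨ trans (+-identityʳ _) (*-identityˡ _) ⟩
    det (minor zero zero B)
      ≈⟨ det-cong (λ i j → +-congˡ (sym (-‿distribˡ-* (A (suc i) zero) (A zero (suc j))))) ⟩
    det (λ i j → A (suc i) (suc j) - A (suc i) zero * A zero (suc j)) ∎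
    where
    g : Fin n → (Fin (suc n) → Carrier) → Fin (suc n) → Carrier
    g i row s = row s + - A (suc i) zero * A zero s
    B : Matrix (suc n)
    B = A zero ∷ (λ i → g i (A (suc i)))
    step : ∀ i v → det (A zero ∷ v) ≈ det (A zero ∷ updateAt v i (g i))
    step i v = det-add-row (det-alternating {i = suc i} {zero} (λ ())) (λ ()) (- A (suc i) zero)
      {A zero ∷ v} {A zero ∷ updateAt v i (g i)}
      (λ s → reflexive (≡.cong-app (updateAt-updates i {g i} v) s))
      λ { zero    r≢i s → refl
        ; (suc r) r≢i s → reflexive (≡.sym (≡.cong-app
            (updateAt-minimal r i v (r≢i ∘ ≡.cong suc)) s)) }
    cleared : ∀ i → B (suc i) zero ≈ 0#
    cleared i = begin
      A (suc i) zero + - A (suc i) zero * A zero zero ≈⟨ +-congˡ (*-congˡ A₀₀≈1) ⟩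
      A (suc i) zero + - A (suc i) zero * 1#          ≈⟨ +-congˡ (*-identityʳ _) ⟩
      A (suc i) zero - A (suc i) zero                 ≈⟨ -‿inverseʳ _ ⟩
      0#                                              ∎

  -- The `does` fields of the two decisions agree by computation, and `isYes≗does` transfers this to
  -- the test inside `I`.
  I-suc : ∀ {n} (i j : Fin n) → I (suc i) (suc j) ≡ I i j
  I-suc i j = ≡.cong (λ b → if b then 1# else 0#)
    (≡.trans (isYes≗does (suc i Fin.≟ suc j)) (≡.sym (isYes≗does (i Fin.≟ j))))

  -- The identity corner is pivoted away one row at a time. Off the diagonal its first row and
  -- column vanish, so a pivot changes neither the remaining corner nor the blocks beside and below
  -- it; on the last block it contributes one term of the sum.
  det-Schur : ∀ l {n} (A : Matrix (l ℕ.+ n)) →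
    (∀ i j → A (i ↑ˡ n) (j ↑ˡ n) ≈ I i j) →
    det A ≈ det (λ i j → A (l ↑ʳ i) (l ↑ʳ j) - sum (λ k → A (l ↑ʳ i) (k ↑ˡ n) * A (k ↑ˡ n) (l ↑ʳ j)))
  det-Schur zero    {n} A A≈I = det-cong {A = A} λ i j → sym (x-0≈x refl)
  det-Schur (suc l) {n} A A≈I = begin
    det A ≈⟨ det-pivot A (A≈I zero zero) ⟩
    det S ≈⟨ det-Schur l S S≈I ⟩
    det (λ i j → S (l ↑ʳ i) (l ↑ʳ j) - sum (λ k → S (l ↑ʳ i) (k ↑ˡ n) * S (k ↑ˡ n) (l ↑ʳ j)))
      ≈⟨ det-cong entry ⟩
    det (λ i j → A (suc (l ↑ʳ i)) (suc (l ↑ʳ j)) -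
        sum (λ k → A (suc (l ↑ʳ i)) (k ↑ˡ n) * A (k ↑ˡ n) (suc (l ↑ʳ j)))) ∎
    where
    S : Matrix (l ℕ.+ n)
    S i j = A (suc i) (suc j) - A (suc i) zero * A zero (suc j)
    S-left : ∀ i (k : Fin l) → S i (k ↑ˡ n) ≈ A (suc i) (suc (k ↑ˡ n))
    S-left i k = x-0≈x (trans (*-congˡ (A≈I zero (suc k))) (zeroʳ _))
    S-top : ∀ (k : Fin l) j → S (k ↑ˡ n) j ≈ A (suc (k ↑ˡ n)) (suc j)
    S-top k j = x-0≈x (trans (*-congʳ (A≈I (suc k) zero)) (zeroˡ _))
    S≈I : ∀ i j → S (i ↑ˡ n) (j ↑ˡ n) ≈ I i j
    S≈I i j = trans (S-top i _) (trans (A≈I (suc i) (suc j)) (reflexive (I-suc i j)))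
    entry : ∀ i j →
      S (l ↑ʳ i) (l ↑ʳ j) - sum (λ k → S (l ↑ʳ i) (k ↑ˡ n) * S (k ↑ˡ n) (l ↑ʳ j)) ≈
      A (suc (l ↑ʳ i)) (suc (l ↑ʳ j)) -
        sum (λ k → A (suc (l ↑ʳ i)) (k ↑ˡ n) * A (k ↑ˡ n) (suc (l ↑ʳ j)))
    entry i j = begin
      (x - y) - sum (λ k → S (l ↑ʳ i) (k ↑ˡ n) * S (k ↑ˡ n) (l ↑ʳ j))
        ≈⟨ +-assoc _ _ _ ⟩
      x + (- y - sum (λ k → S (l ↑ʳ i) (k ↑ˡ n) * S (k ↑ˡ n) (l ↑ʳ j)))
        ≈⟨ +-congˡ (-‿+-comm _ _) ⟩
      x - (y + sum (λ k → S (l ↑ʳ i) (k ↑ˡ n) * S (k ↑ˡ n) (l ↑ʳ j)))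
        ≈⟨ +-congˡ (-‿cong (+-congˡ (sum-cong-≋ {l} λ k → *-cong (S-left (l ↑ʳ i) k) (S-top k (l ↑ʳ j))))) ⟩
      x - (y + sum (λ k → A (suc (l ↑ʳ i)) (suc (k ↑ˡ n)) * A (suc (k ↑ˡ n)) (suc (l ↑ʳ j)))) ∎
      where
      x = A (suc (l ↑ʳ i)) (suc (l ↑ʳ j))
      y = A (suc (l ↑ʳ i)) zero * A zero (suc (l ↑ʳ j))

  -- Block matrices

  Blocks : ℕ → ℕ → Set c
  Blocks m l = Fin m → Fin m → Matrix l

  flattenRows : ∀ {m l n} → (Fin m → Fin l → Vector Carrier n) → Fin (m ℕ.* l) → Vector Carrier n
  flattenRows {m} {l} W r = W (quotient l r) (remainder {m} l r)

  -- With this layout `𝔔 a m` unfolds to `flatten (block a m)`.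
  flatten : ∀ {m l} → Blocks m l → Matrix (m ℕ.* l)
  flatten {m} {l} F = flattenRows λ i r s → F i (quotient l s) r (remainder {m} l s)

  flattenRows-combine : ∀ {m l n} (W : Fin m → Fin l → Vector Carrier n) i r →
    flattenRows W (combine i r) ≡ W i r
  flattenRows-combine W i r = ≡.cong (λ (i , r) → W i r) (Fin.remQuot-combine i r)

  flatten-combine : ∀ {m l} (F : Blocks m l) i r j s →
    flatten F (combine i r) (combine j s) ≡ F i j r s
  flatten-combine {m} {l} F i r j s =
    ≡.cong₂ (λ (i , r) (j , s) → F i j r s) (Fin.remQuot-combine i r) (Fin.remQuot-combine j s)

  det-flattenRows-cong : ∀ {m l} {W W′ : Fin m → Fin l → Vector Carrier (m ℕ.* l)} →
    (∀ i r s → W i r s ≈ W′ i r s) → det (flattenRows W) ≈ det (flattenRows W′)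
  det-flattenRows-cong {m} {l} {W} {W′} W≈W′ = det-cong {A = flattenRows W} {flattenRows W′}
    λ p → W≈W′ (quotient l p) (remainder {m} l p)

  det-flatten-cong : ∀ {m l} {F G : Blocks m l} → (∀ i j → F i j ≈ᴹ G i j) →
    det (flatten F) ≈ det (flatten G)
  det-flatten-cong {m} {l} F≈G = det-flattenRows-cong λ i r s →
    F≈G i (quotient l s) r (remainder {m} l s)

  -- By computation `combine zero k` is `k ↑ˡ (m ℕ.* l)` and `combine (suc i) r` is
  -- `l ↑ʳ combine i r`, so `det-Schur` applies to the flattened matrix directly.
  det-flatten-Schur : ∀ {m l} (F : Blocks (suc m) l) → F zero zero ≈ᴹ I →
    det (flatten F) ≈ det (flatten λ i j → F (suc i) (suc j) -ᴹ F (suc i) zero *ᴹ F zero (suc j))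
  det-flatten-Schur {m} {l} F F≈I = trans
    (det-Schur l (flatten F) λ r s → trans (reflexive (flatten-combine F zero r zero s)) (F≈I r s))
    (det-cong {B = flatten G}
      (combine-elim _ λ i r → combine-elim _ λ j s → entry i r j s))
    where
    G : Blocks m l
    G i j = F (suc i) (suc j) -ᴹ F (suc i) zero *ᴹ F zero (suc j)
    entry : ∀ i r j s →
      flatten F (combine (suc i) r) (combine (suc j) s) -
        sum (λ k → flatten F (combine (suc i) r) (combine {suc m} zero k) *
                   flatten F (combine {suc m} zero k) (combine (suc j) s)) ≈
      flatten G (combine i r) (combine j s)
    entry i r j s = begin
      _ ≈⟨ +-cong (reflexive (flatten-combine F (suc i) r (suc j) s))
             (-‿cong (sum-cong-≋ {l} λ k → *-cong
               (reflexive (flatten-combine F (suc i) r zero k))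
               (reflexive (flatten-combine F zero k (suc j) s)))) ⟩
      G i j r s ≡⟨ flatten-combine G i r j s ⟨
      flatten G (combine i r) (combine j s) ∎

  -- Turning (u , v) into (v , - u), rather than exchanging u and v, brings the pivot block
  -- into the corner without a sign depending on l.
  turn : ∀ {m l} → Blocks (suc (suc m)) l → Blocks (suc (suc m)) l
  turn F zero          j r s = F (suc zero) j r s
  turn F (suc zero)    j r s = - F zero j r s
  turn F (suc (suc i)) j     = F (suc (suc i)) j

  -- The two block rows form a vector of `l` pairs of rows. `det-turn-rows` turns one pair, and
  -- `update-everywhere` extends this to all of them.
  det-turn : ∀ {m l} (F : Blocks (suc (suc m)) l) → det (flatten F) ≈ det (flatten (turn F))
  det-turn {m} {l} F = begin
    det (flatten F)
      ≈⟨ det-flattenRows-cong {W = rows F} {W v₀}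
           (λ { zero r s → refl ; (suc zero) r s → refl ; (suc (suc i)) r s → refl }) ⟩
    det (flattenRows (W v₀))
      ≈⟨ update-everywhere (det ∘ flattenRows ∘ W) W-cong (λ _ → quarterTurn) step v₀ ⟩
    det (flattenRows (W (quarterTurn ∘ v₀)))
      ≈⟨ det-flattenRows-cong {W = W (quarterTurn ∘ v₀)} {rows (turn F)}
           (λ { zero r s → refl ; (suc zero) r s → refl ; (suc (suc i)) r s → refl }) ⟩
    det (flatten (turn F)) ∎
    where
    N : ℕ
    N = suc (suc m) ℕ.* l
    Row : Set c
    Row = Vector Carrier N
    rows : Blocks (suc (suc m)) l → Fin (suc (suc m)) → Fin l → Row
    rows F i r s = F i (quotient l s) r (remainder {suc (suc m)} l s)
    W : Vector (Row × Row) l → Fin (suc (suc m)) → Fin l → Row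
    W v zero          r = proj₁ (v r)
    W v (suc zero)    r = proj₂ (v r)
    W v (suc (suc i)) r = rows F (suc (suc i)) r
    v₀ : Vector (Row × Row) l
    v₀ r = rows F zero r , rows F (suc zero) r
    quarterTurn : Row × Row → Row × Row
    quarterTurn (u , v) = v , λ s → - u s
    at : ∀ v i r s → flattenRows (W v) (combine i r) s ≡ W v i r s
    at v i r = ≡.cong-app (flattenRows-combine (W v) i r)
    W-cong : ∀ {v w} → (∀ r → v r ≡ w r) → det (flattenRows (W v)) ≈ det (flattenRows (W w))
    W-cong {v} {w} v≡w = det-flattenRows-cong {W = W v} {W w} λ
      { zero          r s → reflexive (≡.cong (λ p → proj₁ p s) (v≡w r))
      ; (suc zero)    r s → reflexive (≡.cong (λ p → proj₂ p s) (v≡w r))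
      ; (suc (suc i)) r s → refl }
    step : ∀ r v → det (flattenRows (W v)) ≈ det (flattenRows (W (updateAt v r quarterTurn)))
    step r v = det-turn-rows {i = p} {q} (det-alternating p≢q) p≢q
      {flattenRows (W v)} {flattenRows (W w)}
      (λ s → reflexive (≡.trans (at w zero r s) (≡.trans
        (≡.cong (λ p → proj₁ p s) (updateAt-updates r v)) (≡.sym (at v (suc zero) r s)))))
      (λ s → reflexive (≡.trans (at w (suc zero) r s) (≡.trans
        (≡.cong (λ p → proj₂ p s) (updateAt-updates r v)) (≡.cong (-_) (≡.sym (at v zero r s))))))
      (combine-elim {m = suc (suc m)} _ others)
      where
      w : Vector (Row × Row) l
      w = updateAt v r quarterTurn
      p q : Fin N
      p = combine {suc (suc m)} zero r
      q = combine {suc (suc m)} (suc zero) r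
      p≢q : p ≢ q
      p≢q eq with () ← Fin.combine-injectiveˡ {suc (suc m)} zero r (suc zero) r eq
      others : ∀ (i : Fin (suc (suc m))) r′ → combine i r′ ≢ p → combine i r′ ≢ q → ∀ s →
        flattenRows (W v) (combine i r′) s ≈ flattenRows (W w) (combine i r′) s
      others i r′ ≢p ≢q s = reflexive
        (≡.trans (at v i r′ s) (≡.trans (kept i ≢p ≢q) (≡.sym (at w i r′ s))))
        where
        kept : ∀ (i : Fin (suc (suc m))) → combine i r′ ≢ p → combine i r′ ≢ q → W v i r′ s ≡ W w i r′ s
        kept zero ≢p ≢q = ≡.cong (λ p → proj₁ p s)
          (≡.sym (updateAt-minimal r′ r v (≢p ∘ ≡.cong (combine {suc (suc m)} {l} zero))))
        kept (suc zero) ≢p ≢q = ≡.cong (λ p → proj₂ p s)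
          (≡.sym (updateAt-minimal r′ r v (≢q ∘ ≡.cong (combine {suc (suc m)} (suc zero)))))
        kept (suc (suc i)) ≢p ≢q = ≡.refl

  -- This bridges sizes that are equal but not by computation, such as `1 ℕ.* l` and `l`. Once the
  -- sizes are identified, a map that preserves `toℕ` is the identity.
  det-reindex : ∀ {m n} (A : Matrix n) (f : Fin m → Fin n) → m ≡ n → (∀ i → toℕ (f i) ≡ toℕ i) →
    det A ≈ det (λ i j → A (f i) (f j))
  det-reindex A f ≡.refl f≗id = det-cong λ i j →
    reflexive (≡.cong₂ A (≡.sym (Fin.toℕ-injective (f≗id i))) (≡.sym (Fin.toℕ-injective (f≗id j))))

  det-flatten₁ : ∀ {l} (F : Blocks 1 l) → det (flatten F) ≈ det (F zero zero)
  det-flatten₁ {l} F = trans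
    (det-reindex (flatten F) (combine {1} zero) (≡.sym (ℕ.+-identityʳ l)) (λ i → Fin.toℕ-↑ˡ i 0))
    (det-cong λ r s → reflexive (flatten-combine F zero r zero s))

  -- Matrix algebra

  ≈ᴹ-refl : ∀ {n} {A : Matrix n} → A ≈ᴹ A
  ≈ᴹ-refl i j = refl

  sum-I : ∀ {n} (f : Vector Carrier n) i → sum (λ k → f k * I k i) ≈ f i
  sum-I f zero = begin
    f zero * 1# + sum (λ k → f (suc k) * 0#) ≈⟨ +-cong (*-identityʳ _) (sum-zero λ k → zeroʳ (f (suc k))) ⟩
    f zero + 0#                              ≈⟨ +-identityʳ _ ⟩
    f zero                                   ∎
  sum-I f (suc i) = begin
    f zero * 0# + sum (λ k → f (suc k) * I (suc k) (suc i))
      ≈⟨ +-cong (zeroʳ _) (sum-cong-≋ λ k → *-congˡ {f (suc k)} (reflexive (I-suc k i))) ⟩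
    0# + sum (λ k → f (suc k) * I k i)
      ≈⟨ trans (+-identityˡ _) (sum-I (f ∘ suc) i) ⟩
    f (suc i) ∎

  I-sym : ∀ {n} (i j : Fin n) → I i j ≡ I j i
  I-sym zero    zero    = ≡.refl
  I-sym zero    (suc j) = ≡.refl
  I-sym (suc i) zero    = ≡.refl
  I-sym (suc i) (suc j) = ≡.trans (I-suc i j) (≡.trans (I-sym i j) (≡.sym (I-suc j i)))

  *ᴹ-identityʳ : ∀ {n} (A : Matrix n) → A *ᴹ I ≈ᴹ A
  *ᴹ-identityʳ A i = sum-I (A i)

  *ᴹ-identityˡ : ∀ {n} (A : Matrix n) → I *ᴹ A ≈ᴹ A
  *ᴹ-identityˡ A i j = trans
    (sum-cong-≋ λ k → trans (*-comm _ _) (*-congˡ {A k j} (reflexive (I-sym i k))))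
    (sum-I (λ k → A k j) i)

  *ᴹ-zeroʳ : ∀ {n} (A : Matrix n) → A *ᴹ O ≈ᴹ O
  *ᴹ-zeroʳ A i j = sum-zero λ k → zeroʳ (A i k)

  *ᴹ-assoc : ∀ {n} (A B C : Matrix n) → (A *ᴹ B) *ᴹ C ≈ᴹ A *ᴹ (B *ᴹ C)
  *ᴹ-assoc A B C i j = begin
    sum (λ k → sum (λ h → A i h * B h k) * C k j)
      ≈⟨ sum-cong-≋ (λ k → *-distribʳ-sum (C k j) (λ h → A i h * B h k)) ⟩
    sum (λ k → sum (λ h → A i h * B h k * C k j))
      ≈⟨ ∑-comm (λ k h → A i h * B h k * C k j) ⟩
    sum (λ h → sum (λ k → A i h * B h k * C k j))
      ≈⟨ sum-cong-≋ (λ h → sum-cong-≋ (λ k → *-assoc (A i h) (B h k) (C k j))) ⟩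
    sum (λ h → sum (λ k → A i h * (B h k * C k j)))
      ≈⟨ sum-cong-≋ (λ h → *-distribˡ-sum (A i h) (λ k → B h k * C k j)) ⟨
    sum (λ h → A i h * sum (λ k → B h k * C k j)) ∎

  *ᴹ-distribˡ-sub : ∀ {n} (A B C : Matrix n) → A *ᴹ (B -ᴹ C) ≈ᴹ A *ᴹ B -ᴹ A *ᴹ C
  *ᴹ-distribˡ-sub A B C i j = trans
    (sum-cong-≋ λ k → x[y-z]≈xy-xz (A i k) (B k j) (C k j))
    (sum-sub (λ k → A i k * B k j) (λ k → A i k * C k j))

  *ᴹ-distribʳ-sub : ∀ {n} (A B C : Matrix n) → (B -ᴹ C) *ᴹ A ≈ᴹ B *ᴹ A -ᴹ C *ᴹ A
  *ᴹ-distribʳ-sub A B C i j = trans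
    (sum-cong-≋ λ k → [y-z]x≈yx-zx (A k j) (B i k) (C i k))
    (sum-sub (λ k → B i k * A k j) (λ k → C i k * A k j))

  -- Block tridiagonal determinants and the Chebyshev recursion

  module _ {l} (a : ℕ → Matrix l) where

    -- Removing the first block row and column of `𝔔 a (suc m)` leaves `𝔔 a m`: the index of the
    -- diagonal block and the `does` of both tests agree by computation.
    block-suc : ∀ {m} i j → block a (suc m) (suc i) (suc j) ≡ block a m i j
    block-suc {m} i j = ≡.cong₂
      (λ b b′ → if b then a (m ℕ.∸ toℕ i) else if b′ then I else O)
      (same (suc i Fin.≟ suc j) (i Fin.≟ j) ≡.refl)
      (same ((suc (suc (toℕ i)) ℕ.≟ suc (toℕ j)) ⊎-dec (suc (suc (toℕ j)) ℕ.≟ suc (toℕ i)))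
            ((suc (toℕ i) ℕ.≟ toℕ j) ⊎-dec (suc (toℕ j) ℕ.≟ toℕ i)) ≡.refl)
      where
      same : ∀ {p q} {P : Set p} {Q : Set q} (P? : Dec P) (Q? : Dec Q) →
             does P? ≡ does Q? → ⌊ P? ⌋ ≡ ⌊ Q? ⌋
      same P? Q? eq = ≡.trans (isYes≗does P?) (≡.trans eq (≡.sym (isYes≗does Q?)))

    -- `flatten (headed k X Y)` is the matrix whose determinant is `D k X Y`.
    headed : ∀ k → Matrix l → Matrix l → Blocks (suc k) l
    headed k X Y zero    zero          = X
    headed k X Y zero    (suc zero)    = Y
    headed k X Y zero    (suc (suc j)) = O
    headed k X Y (suc i) j             = block a (suc k) (suc i) j

    -- The turn moves (I , a_{k+1} , I , O , ...) to the top and places (- X , - Y , O , ...) below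
    -- it. Eliminating the first block column then gives the new head - Y + X a_{k+1} followed by O
    -- + X I.
    det-headed-step : ∀ k X Y →
      det (flatten (headed (suc k) X Y)) ≈ det (flatten (headed k (X *ᴹ a (suc k) -ᴹ Y) X))
    det-headed-step k X Y = begin
      det (flatten F)          ≈⟨ det-turn F ⟩
      -- The corner block is the former subdiagonal block, which computes to `I`.
      det (flatten (turn F))   ≈⟨ det-flatten-Schur (turn F) ≈ᴹ-refl ⟩
      det (flatten G)          ≈⟨ det-flatten-cong {F = G} {H} G≈H ⟩
      det (flatten H)          ∎
      where
      F : Blocks (suc (suc k)) l
      F = headed (suc k) X Y
      G H : Blocks (suc k) l
      G i j = turn F (suc i) (suc j) -ᴹ turn F (suc i) zero *ᴹ turn F zero (suc j)
      H = headed k (X *ᴹ a (suc k) -ᴹ Y) X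
      -- In a given column, `U` is the block of the old head and `V` that of the pivot row; the sign
      -- from the turn makes the product `X V` enter positively.
      first : ∀ (U V : Matrix l) r s → - U r s - sum (λ h → - X r h * V h s) ≈ (X *ᴹ V -ᴹ U) r s
      first U V r s = begin
        - U r s - sum (λ h → - X r h * V h s)
          ≈⟨ +-congˡ (-‿cong (sum-cong-≋ λ h → sym (-‿distribˡ-* (X r h) (V h s)))) ⟩
        - U r s - sum (λ h → - (X r h * V h s))
          ≈⟨ +-congˡ (-‿cong (sum-neg (λ h → X r h * V h s))) ⟩
        - U r s - - (X *ᴹ V) r s
          ≈⟨ +-congˡ (-‿involutive _) ⟩
        - U r s + (X *ᴹ V) r s
          ≈⟨ +-comm _ _ ⟩
        (X *ᴹ V -ᴹ U) r s ∎
      G≈H : ∀ i j → G i j ≈ᴹ H i j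
      G≈H zero zero r s = first Y (a (suc k)) r s
      G≈H zero (suc zero) r s =
        trans (first O I r s) (trans (x-0≈x refl) (*ᴹ-identityʳ X r s))
      G≈H zero (suc (suc j)) r s =
        trans (first O O r s) (trans (x-0≈x refl) (*ᴹ-zeroʳ X r s))
      -- These block rows have `O` in the first column, so elimination leaves them as they are.
      G≈H (suc i) j r s = trans
        (x-0≈x (sum-zero λ h → zeroˡ (turn F zero (suc j) h s)))
        (reflexive (≡.cong (λ M → M r s) (block-suc {suc k} (suc i) j)))

    -- Since `𝔭₋₁ a k` has index k - 1, the right side for k = 0 involves X I - Y O. In the step, (X
    -- A - Y) P - X P′ and X (A P - P′) - Y P consist of the same three terms, and A P - P′ is the
    -- next polynomial by definition.
    det-headed : ∀ k X Y → det (flatten (headed k X Y)) ≈ det (X *ᴹ 𝔭 a k -ᴹ Y *ᴹ 𝔭₋₁ a k)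
    det-headed zero X Y = trans (det-flatten₁ (headed zero X Y)) (det-cong {A = X} λ r s →
      sym (trans (x-0≈x (*ᴹ-zeroʳ Y r s)) (*ᴹ-identityʳ X r s)))
    det-headed (suc k) X Y = begin
      det (flatten (headed (suc k) X Y))
        ≈⟨ det-headed-step k X Y ⟩
      det (flatten (headed k (X *ᴹ A -ᴹ Y) X))
        ≈⟨ det-headed k (X *ᴹ A -ᴹ Y) X ⟩
      det ((X *ᴹ A -ᴹ Y) *ᴹ P -ᴹ X *ᴹ P′)
        ≈⟨ det-cong entry ⟩
      det (X *ᴹ (A *ᴹ P -ᴹ P′) -ᴹ Y *ᴹ P) ∎
      where
      A P P′ : Matrix l
      A  = a (suc k)
      P  = 𝔭 a k
      P′ = 𝔭₋₁ a k
      x-y-z≈x-z-y : ∀ x y z → x - y - z ≈ x - z - y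
      x-y-z≈x-z-y x y z =
        trans (+-assoc _ _ _) (trans (+-congˡ (+-comm _ _)) (sym (+-assoc _ _ _)))
      entry : (X *ᴹ A -ᴹ Y) *ᴹ P -ᴹ X *ᴹ P′ ≈ᴹ X *ᴹ (A *ᴹ P -ᴹ P′) -ᴹ Y *ᴹ P
      entry r s = begin
        ((X *ᴹ A -ᴹ Y) *ᴹ P) r s - (X *ᴹ P′) r s
          ≈⟨ +-congʳ (*ᴹ-distribʳ-sub P (X *ᴹ A) Y r s) ⟩
        (X *ᴹ A *ᴹ P) r s - (Y *ᴹ P) r s - (X *ᴹ P′) r s
          ≈⟨ +-congʳ (+-congʳ (*ᴹ-assoc X A P r s)) ⟩
        (X *ᴹ (A *ᴹ P)) r s - (Y *ᴹ P) r s - (X *ᴹ P′) r s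
          ≈⟨ x-y-z≈x-z-y _ _ _ ⟩
        (X *ᴹ (A *ᴹ P)) r s - (X *ᴹ P′) r s - (Y *ᴹ P) r s
          ≈⟨ +-congʳ (*ᴹ-distribˡ-sub X (A *ᴹ P) P′ r s) ⟨
        (X *ᴹ (A *ᴹ P -ᴹ P′)) r s - (Y *ᴹ P) r s ∎

    det-𝔔 : ∀ m → det (𝔔 a (suc m)) ≈ det (𝔭 a (suc m))
    det-𝔔 m = begin
      det (𝔔 a (suc m))
        ≈⟨ det-flatten-cong {F = block a (suc m)} {headed m (a (suc m)) I} 𝔔≈headed ⟩
      det (flatten (headed m (a (suc m)) I))
        ≈⟨ det-headed m (a (suc m)) I ⟩
      det (a (suc m) *ᴹ 𝔭 a m -ᴹ I *ᴹ 𝔭₋₁ a m)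
        -- After the factor `I` is removed, the matrix is the defining recursion of `𝔭 a (suc m)`.
        ≈⟨ det-cong (λ r s → +-congˡ (-‿cong (*ᴹ-identityˡ (𝔭₋₁ a m) r s))) ⟩
      det (𝔭 a (suc m)) ∎
      where
      𝔔≈headed : ∀ i j → block a (suc m) i j ≈ᴹ headed m (a (suc m)) I i j
      𝔔≈headed zero    zero          = ≈ᴹ-refl
      𝔔≈headed zero    (suc zero)    = ≈ᴹ-refl
      𝔔≈headed zero    (suc (suc j)) = ≈ᴹ-refl
      𝔔≈headed (suc i) j             = ≈ᴹ-refl

open import Defs

proposition45 : ∀ (l : ℕ) (a : ℕ → Matrix l) → (∀ i → 1 ≤ i → InGL (a i)) →
    ∀ (m : ℕ) → 1 ≤ m → det (𝔔 a m) ≈ℂ det (𝔭 a m)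
proposition45 l a _ (suc m) _ = Determinants.det-𝔔 ℂ-commutativeRing a m
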